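{- Let $\delta\le\delta'$ (component-wise) be two increment functions of size $n$. Let $P\triangleleft Q$ be a covering relation in $\operatorname{Tam}^{\delta'}_n$. Then $P<Q$ in $\operatorname{Tam}^{\delta}_n$.
   Context: $P\triangleleft Q$ denotes a covering relation: $P<Q$ with no element strictly between. Dyck paths. A Dyck path of size (or length) $n$ is a word with $n$ letters $u$ (up steps) and $n$ letters $d$ (down steps) such that every prefix contains at least as many $u$ as $d$. Its up steps are numbered $u_1,\dots,u_n$ from left to right. A subword is a portion of consecutive letters. A valley is a down step immediately followed by an up step. Alt-Tamari posets. An increment function of size $n$ is a function $\delta\colon\{1,\dots,n\}\to\{0,1\}$. Put $\delta(u_i)=\delta(i)$, $\delta(d)=-1$, and $\delta(A)=\sum_{s\in A}\delta(s)$ for a subword $A$ of a Dyck path $P$ of size $n$. The $\delta$-excursion of $u_i$ in $P$ is the smallest (nonempty) subword $C_i$ of $P$ starting with $u_i$ such that $\delta(C_i)=0$ (it always exists). If $P$ has a valley $du_i$, the $\delta$-rotation of $P$ at $u_i$ is the Dyck path $Q$ obtained by exchanging the down step preceding $u_i$ with the $\delta$-excursion $C_i$ of $u_i$: $P=A\,d\,C_i\,B$ and $Q=A\,C_i\,d\,B$. The alt-Tamari poset $\operatorname{Tam}^\delta_n$ is the set of Dyck paths of size $n$ with the order given by the reflexive transitive closure of the relation "$Q$ is a $\delta$-rotation of $P$" (with $P$ below $Q$); this is a partial order. -}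

module Defs where

open import Data.Fin using (Fin; toℕ; fromℕ<)
open import Data.Integer using (ℤ; +_; -1ℤ; 0ℤ) renaming (_+_ to _+ℤ_)
open import Data.List using (List; []; _∷_; _++_; length; filter)
open import Data.Nat using (ℕ; suc; _≤_; _<?_)
open import Data.Product using (_×_; ∃-syntax)
open import Level using (_⊔_; 0ℓ)
open import Relation.Binary.Construct.Closure.ReflexiveTransitive using (Star)
open import Relation.Binary.Construct.NonStrictToStrict as ToStrict using ()
open import Relation.Binary.Core using (Rel)
open import Relation.Binary.Definitions using (DecidableEquality)
open import Relation.Binary.PropositionalEquality using (_≡_; refl)
open import Relation.Nullary using (¬_; yes; no)

data Step : Set where
  u d : Step

_≟_ : DecidableEquality Step
u ≟ u = yes refl
u ≟ d = no λ ()
d ≟ u = no λ ()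
d ≟ d = yes refl

#u #d : List Step → ℕ
#u w = length (filter (_≟ u) w)
#d w = length (filter (_≟ d) w)

-- The proof fields are irrelevant, so that _≡_ on Dyck paths is equality of
-- the underlying words.
record DyckPath (n : ℕ) : Set where
  constructor dyck
  field
    word    : List Step
    .ups    : #u word ≡ n
    .downs  : #d word ≡ n
    .ballot : ∀ A B → word ≡ A ++ B → #d A ≤ #u A

open DyckPath public using (word)

-- Up steps are numbered from 0: the value δ(uᵢ) is that of δ at i ∸ 1.
IncrementFunction : ℕ → Set
IncrementFunction n = Fin n → Fin 2

-- The value of the up step with (zero-based) number k.  The second case never
-- concerns an up step of a Dyck path of size n.
δ-up : ∀ {n} → IncrementFunction n → ℕ → ℕ
δ-up {n} δ k with k <? n
... | yes k<n = toℕ (δ (fromℕ< k<n))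
... | no  _   = 0

-- δ-sum δ k C is δ(C) for a subword C preceded in the path by exactly k up
-- steps, i.e. whose first up step has (zero-based) number k.
δ-sum : ∀ {n} → IncrementFunction n → ℕ → List Step → ℤ
δ-sum δ k []      = 0ℤ
δ-sum δ k (u ∷ C) = + δ-up δ k +ℤ δ-sum δ (suc k) C
δ-sum δ k (d ∷ C) = -1ℤ +ℤ δ-sum δ k C

-- The path has, after k up steps, a remaining portion C ++ B beginning with its
-- up step number k, and C is the δ-excursion of that up step: the smallest
-- subword starting there whose δ-value is zero.
record IsExcursion {n : ℕ} (δ : IncrementFunction n) (k : ℕ) (C B : List Step) : Set where
  field
    starts-with-u : ∃[ C′ ] C ≡ u ∷ C′
    sum-zero      : δ-sum δ k C ≡ 0ℤ
    smallest      : ∀ D E → C ++ B ≡ (u ∷ D) ++ E → δ-sum δ k (u ∷ D) ≡ 0ℤ →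
                    length C ≤ length (u ∷ D)

record Rotation {n : ℕ} (δ : IncrementFunction n) (P Q : DyckPath n) : Set where
  field
    A C B     : List Step
    before    : word P ≡ A ++ d ∷ C ++ B
    excursion : IsExcursion δ (#u A) C B
    after     : word Q ≡ A ++ C ++ d ∷ B

Tam[_]_≤_ : ∀ {n} → IncrementFunction n → Rel (DyckPath n) 0ℓ
Tam[ δ ] P ≤ Q = Star (Rotation δ) P Q

Tam[_]_<_ : ∀ {n} → IncrementFunction n → Rel (DyckPath n) 0ℓ
Tam[ δ ] P < Q = ToStrict._<_ _≡_ (Tam[ δ ]_≤_) P Q

Covers : ∀ {a ℓ} {X : Set a} → Rel X ℓ → Rel X (a ⊔ ℓ)
Covers _<_ x y = x < y × (∀ z → ¬ (x < z × z < y))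

Tam[_]_⋖_ : ∀ {n} → IncrementFunction n → Rel (DyckPath n) 0ℓ
Tam[ δ ] P ⋖ Q = Covers (Tam[ δ ]_<_) P Q

{-# OPTIONS --safe #-}
module Submission where

-- It suffices to write a single δ′-rotation A d C B → A C d B as a sequence of
-- δ-rotations: the order of Tam^δ′ is then contained in that of Tam^δ, and
-- strictness does not depend on the increment function.
--
-- Since C is a δ′-excursion, its nonempty proper prefixes have positive
-- δ′-value, or C is a single up step; as δ′(C) = 0, every suffix of C has
-- δ′-value at most 0 (excursion⇒suffixes≤0).  As δ ≤ δ′, the same holds for δ
-- (suffixes≤0-antitone).
--
-- Conversely, whenever all suffixes of a word D have δ-value at most 0, a down
-- step in front of D can be moved behind D by δ-rotations (push-down).  If
-- D = d D′, then moving the first letter of d d D′ to the end gives the same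
-- word as moving the second one, and that only has to cross D′.  If D starts
-- with an up step, then δ(D) ≤ 0 forces the δ-excursion E of that step to end
-- within D = E F (first-zero); one rotation moves the down step behind E, and
-- F, a suffix of D, satisfies the same hypothesis.

open import Defs
open import Data.Fin using (_≤_; fromℕ<)
open import Data.Nat using (ℕ)

open import Data.Empty using (⊥)
open import Data.Integer as ℤ using (ℤ; +_; 0ℤ; -1ℤ; +≤+)
import Data.Integer.Properties as ℤ
open import Data.List using (List; []; _∷_; _++_; length; filter)
open import Data.List.Properties using (++-assoc; ∷-injective; ∷-injectiveʳ; filter-++; length-++)
open import Data.List.Relation.Binary.Permutation.Propositional using (_↭_)
open import Data.List.Relation.Binary.Permutation.Propositional.Properties
  using (↭-length; filter-↭; shift; ++⁺ˡ)
open import Data.Nat as ℕ using (zero; suc; z≤n; s≤s; _<?_)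
open import Data.Nat.Induction using (Acc; acc; <-wellFounded)
import Data.Nat.Properties as ℕ
open import Data.Product using (_×_; _,_; ∃-syntax)
open import Data.Unit using (⊤; tt)
open import Relation.Binary.Construct.Closure.ReflexiveTransitive using (ε; _◅_; _⋆)
open import Relation.Binary.PropositionalEquality
  using (_≡_; refl; sym; trans; cong; subst; module ≡-Reasoning)
open import Relation.Nullary using (yes; no)

-- Moving a down step to the right preserves Dyck paths

-- The word, read from height h, never goes below height 0.
StaysNonneg : ℕ → List Step → Set
StaysNonneg h       []      = ⊤
StaysNonneg h       (u ∷ w) = StaysNonneg (suc h) w
StaysNonneg zero    (d ∷ w) = ⊥
StaysNonneg (suc h) (d ∷ w) = StaysNonneg h w

prefixes⇒staysNonneg : ∀ h w → (∀ X Y → w ≡ X ++ Y → #d X ℕ.≤ h ℕ.+ #u X) →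
                       StaysNonneg h w
prefixes⇒staysNonneg h []      b = tt
prefixes⇒staysNonneg h (u ∷ w) b = prefixes⇒staysNonneg (suc h) w λ X Y eq →
  subst (#d X ℕ.≤_) (ℕ.+-suc h (#u X)) (b (u ∷ X) Y (cong (u ∷_) eq))
prefixes⇒staysNonneg zero (d ∷ w) b with b (d ∷ []) w refl
... | ()
prefixes⇒staysNonneg (suc h) (d ∷ w) b = prefixes⇒staysNonneg h w λ X Y eq →
  ℕ.s≤s⁻¹ (b (d ∷ X) Y (cong (d ∷_) eq))

staysNonneg⇒prefixes : ∀ h w → StaysNonneg h w →
                       ∀ X Y → w ≡ X ++ Y → #d X ℕ.≤ h ℕ.+ #u X
staysNonneg⇒prefixes h w       s []      Y eq   = z≤n
staysNonneg⇒prefixes h (u ∷ _) s (u ∷ X) Y refl =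
  subst (#d X ℕ.≤_) (sym (ℕ.+-suc h (#u X))) (staysNonneg⇒prefixes (suc h) _ s X Y refl)
staysNonneg⇒prefixes (suc h) (d ∷ _) s (d ∷ X) Y refl =
  s≤s (staysNonneg⇒prefixes h _ s X Y refl)

staysNonneg-push : ∀ h C {B} → StaysNonneg h (d ∷ C ++ B) → StaysNonneg h (C ++ d ∷ B)
staysNonneg-push h       []      s = s
staysNonneg-push (suc h) (u ∷ C) s = staysNonneg-push (suc (suc h)) C s
staysNonneg-push (suc h) (d ∷ C) s = staysNonneg-push h C s

staysNonneg-++ˡ : ∀ A {V W} → (∀ h → StaysNonneg h V → StaysNonneg h W) →
                  ∀ h → StaysNonneg h (A ++ V) → StaysNonneg h (A ++ W)
staysNonneg-++ˡ []      f h       s = f h s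
staysNonneg-++ˡ (u ∷ A) f h       s = staysNonneg-++ˡ A f (suc h) s
staysNonneg-++ˡ (d ∷ A) f (suc h) s = staysNonneg-++ˡ A f h s

push-↭ : ∀ (A C B : List Step) → A ++ C ++ d ∷ B ↭ A ++ d ∷ C ++ B
push-↭ A C B = ++⁺ˡ A (shift d C B)

-- The Dyck path A C d B, for a Dyck path A d C B.
pushed : ∀ {n} A C B (P : DyckPath n) → word P ≡ A ++ d ∷ C ++ B → DyckPath n
pushed A C B (dyck _ ups downs ballot) refl = dyck (A ++ C ++ d ∷ B)
  (trans (↭-length (filter-↭ (_≟ u) (push-↭ A C B))) ups)
  (trans (↭-length (filter-↭ (_≟ d) (push-↭ A C B))) downs)
  (staysNonneg⇒prefixes 0 _
    (staysNonneg-++ˡ A (λ h → staysNonneg-push h C) 0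
      (prefixes⇒staysNonneg 0 _ ballot)))

word-pushed : ∀ {n} A C B (P : DyckPath n) (eq : word P ≡ A ++ d ∷ C ++ B) →
              word (pushed A C B P eq) ≡ A ++ C ++ d ∷ B
word-pushed A C B (dyck _ _ _ _) refl = refl

word-injective : ∀ {n} {P Q : DyckPath n} → word P ≡ word Q → P ≡ Q
word-injective {P = dyck _ _ _ _} {dyck _ _ _ _} refl = refl

#u-++ : ∀ A C → #u (A ++ C) ≡ #u C ℕ.+ #u A
#u-++ A C = begin
  #u (A ++ C)                                   ≡⟨ cong length (filter-++ (_≟ u) A C) ⟩
  length (filter (_≟ u) A ++ filter (_≟ u) C)   ≡⟨ length-++ (filter (_≟ u) A) ⟩
  #u A ℕ.+ #u C                                 ≡⟨ ℕ.+-comm (#u A) (#u C) ⟩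
  #u C ℕ.+ #u A                                 ∎
  where open ≡-Reasoning

-- Words all of whose suffixes have nonpositive value

-- Every suffix of C has δ-value at most 0, where C is preceded by exactly k up
-- steps.
Suffixes≤0 : ∀ {n} → IncrementFunction n → ℕ → List Step → Set
Suffixes≤0 δ k []      = ⊤
Suffixes≤0 δ k (u ∷ C) = δ-sum δ k (u ∷ C) ℤ.≤ 0ℤ × Suffixes≤0 δ (suc k) C
Suffixes≤0 δ k (d ∷ C) = δ-sum δ k (d ∷ C) ℤ.≤ 0ℤ × Suffixes≤0 δ k C

suffixes≤0-++ʳ : ∀ {n} (δ : IncrementFunction n) k E {F} →
                 Suffixes≤0 δ k (E ++ F) → Suffixes≤0 δ (#u E ℕ.+ k) F
suffixes≤0-++ʳ δ k []      s       = s
suffixes≤0-++ʳ δ k (u ∷ E) {F} (_ , s) =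
  subst (λ j → Suffixes≤0 δ j F) (ℕ.+-suc (#u E) k) (suffixes≤0-++ʳ δ (suc k) E s)
suffixes≤0-++ʳ δ k (d ∷ E) (_ , s) = suffixes≤0-++ʳ δ k E s

δ-up-mono : ∀ {n} {δ δ′ : IncrementFunction n} → (∀ i → δ i ≤ δ′ i) →
            ∀ k → δ-up δ k ℕ.≤ δ-up δ′ k
δ-up-mono {n} δ≤δ′ k with k <? n
... | yes k<n = δ≤δ′ (fromℕ< k<n)
... | no  _   = z≤n

δ-sum-mono : ∀ {n} {δ δ′ : IncrementFunction n} → (∀ i → δ i ≤ δ′ i) →
             ∀ k C → δ-sum δ k C ℤ.≤ δ-sum δ′ k C
δ-sum-mono δ≤δ′ k []      = ℤ.≤-refl
δ-sum-mono δ≤δ′ k (u ∷ C) = ℤ.+-mono-≤ (+≤+ (δ-up-mono δ≤δ′ k)) (δ-sum-mono δ≤δ′ (suc k) C)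
δ-sum-mono δ≤δ′ k (d ∷ C) = ℤ.+-monoʳ-≤ -1ℤ (δ-sum-mono δ≤δ′ k C)

suffixes≤0-antitone : ∀ {n} {δ δ′ : IncrementFunction n} → (∀ i → δ i ≤ δ′ i) →
                      ∀ k C → Suffixes≤0 δ′ k C → Suffixes≤0 δ k C
suffixes≤0-antitone δ≤δ′ k []      _       = tt
suffixes≤0-antitone δ≤δ′ k (u ∷ C) (p , s) =
  ℤ.≤-trans (δ-sum-mono δ≤δ′ k (u ∷ C)) p , suffixes≤0-antitone δ≤δ′ (suc k) C s
suffixes≤0-antitone δ≤δ′ k (d ∷ C) (p , s) =
  ℤ.≤-trans (δ-sum-mono δ≤δ′ k (d ∷ C)) p , suffixes≤0-antitone δ≤δ′ k C s

-- Walks reaching zero for the first time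

-- The height after reading C from starting height s, where C is preceded by
-- exactly k up steps: each up step contributes its δ-value, each down step -1.
level : ∀ {n} → IncrementFunction n → ℕ → ℕ → List Step → ℤ
level δ s k C = + s ℤ.+ δ-sum δ k C

level-u : ∀ {n} (δ : IncrementFunction n) s k C →
          level δ s k (u ∷ C) ≡ level δ (s ℕ.+ δ-up δ k) (suc k) C
level-u δ s k C = sym (ℤ.+-assoc (+ s) (+ δ-up δ k) (δ-sum δ (suc k) C))

level-d : ∀ {n} (δ : IncrementFunction n) s k C →
          level δ (suc s) k (d ∷ C) ≡ level δ s k C
level-d δ s k C = sym (ℤ.+-assoc (+ suc s) -1ℤ (δ-sum δ k C))

-- Starting from height s, no prefix of the word W that is shorter than C ends at
-- level 0.
FirstZero : ∀ {n} → IncrementFunction n → ℕ → ℕ → List Step → List Step → Set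
FirstZero δ s k C W =
  ∀ D E → W ≡ D ++ E → level δ s k D ≡ 0ℤ → length C ℕ.≤ length D

-- The starting height suc s excludes a passage through 0 at the empty prefix.
firstZero-∷ : ∀ {n} (δ : IncrementFunction n) {s k t j x} C {W} →
              (∀ D → level δ (suc s) k (x ∷ D) ≡ level δ t j D) →
              FirstZero δ t j C W → FirstZero δ (suc s) k (x ∷ C) (x ∷ W)
firstZero-∷ δ C step min []      E eq ()
firstZero-∷ δ C step min (_ ∷ D) E eq z with ∷-injective eq
... | refl , eq′ = s≤s (min D E eq′ (trans (sym (step D)) z))

-- Down steps lower the level by exactly 1, so a walk from s ≥ 0 that ends at a
-- level at most 0 has passed through 0.  The first passage is minimal whatever
-- word X follows it.
first-zero : ∀ {n} (δ : IncrementFunction n) s k W → level δ s k W ℤ.≤ 0ℤ →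
             ∃[ C ] ∃[ F ] (W ≡ C ++ F × level δ s k C ≡ 0ℤ ×
                            (∀ X → FirstZero δ s k C (C ++ X)))
first-zero δ zero    k W       p = [] , W , refl , refl , λ _ _ _ _ _ → z≤n
first-zero δ (suc s) k []      (+≤+ ())
first-zero δ (suc s) k (u ∷ W) p
  with first-zero δ (suc s ℕ.+ δ-up δ k) (suc k) W (subst (ℤ._≤ 0ℤ) (level-u δ (suc s) k W) p)
... | C , F , refl , zeroC , min =
  u ∷ C , F , refl , trans (level-u δ (suc s) k C) zeroC ,
  λ X → firstZero-∷ δ C (level-u δ (suc s) k) (min X)
first-zero δ (suc s) k (d ∷ W) p
  with first-zero δ s k W (subst (ℤ._≤ 0ℤ) (level-d δ s k W) p)
... | C , F , refl , zeroC , min =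
  d ∷ C , F , refl , trans (level-d δ s k C) zeroC ,
  λ X → firstZero-∷ δ C (level-d δ s k) (min X)

excursion-exists : ∀ {n} (δ : IncrementFunction n) k W → δ-sum δ k (u ∷ W) ℤ.≤ 0ℤ →
                   ∃[ C ] ∃[ F ] (W ≡ C ++ F × (∀ X → IsExcursion δ k (u ∷ C) X))
excursion-exists δ k W p with first-zero δ (δ-up δ k) (suc k) W p
... | C , F , eq , zeroC , min = C , F , eq , λ X → record
  { starts-with-u = C , refl
  ; sum-zero      = zeroC
  ; smallest      = λ D E eq z → s≤s (min X D E (∷-injectiveʳ eq) z)
  }

-- A walk from s ≥ 0 that stays positive until its end at level 0 descends, from
-- any of its points, by a nonnegative amount.
first-zero⇒suffixes≤0 : ∀ {n} (δ : IncrementFunction n) s k C → level δ s k C ≡ 0ℤ →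
                        FirstZero δ s k C C → Suffixes≤0 δ k C
first-zero⇒suffixes≤0 δ s k C z min = go s k C z min
  where
  sum≤0 : ∀ s k C → level δ s k C ≡ 0ℤ → δ-sum δ k C ℤ.≤ 0ℤ
  sum≤0 s k C z = subst (δ-sum δ k C ℤ.≤_) z (ℤ.i≤j+i (δ-sum δ k C) (+ s))

  go : ∀ s k C → level δ s k C ≡ 0ℤ → FirstZero δ s k C C → Suffixes≤0 δ k C
  go s k []      z min = tt
  go s k (u ∷ C) z min =
    sum≤0 s k (u ∷ C) z ,
    go (s ℕ.+ δ-up δ k) (suc k) C (trans (sym (level-u δ s k C)) z)
      λ D E eq z′ → ℕ.s≤s⁻¹ (min (u ∷ D) E (cong (u ∷_) eq) (trans (level-u δ s k D) z′))
  -- At level 0 the empty prefix is already a passage through 0.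
  go zero k (d ∷ C) z min with min [] (d ∷ C) refl refl
  ... | ()
  go (suc s) k (d ∷ C) z min =
    sum≤0 (suc s) k (d ∷ C) z ,
    go s k C (trans (sym (level-d δ s k C)) z)
      λ D E eq z′ → ℕ.s≤s⁻¹ (min (d ∷ D) E (cong (d ∷_) eq) (trans (level-d δ s k D) z′))

excursion⇒suffixes≤0 : ∀ {n} {δ : IncrementFunction n} {k C B} →
                       IsExcursion δ k C B → Suffixes≤0 δ k C
excursion⇒suffixes≤0 {δ = δ} {k} {B = B} exc with IsExcursion.starts-with-u exc
... | C , refl =
  ℤ.≤-reflexive sum-zero ,
  first-zero⇒suffixes≤0 δ (δ-up δ k) (suc k) C sum-zero λ D E eq z →
    ℕ.s≤s⁻¹ (smallest D (E ++ B)
      (cong (u ∷_) (trans (cong (_++ B) eq) (++-assoc D E B))) z)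
  where open IsExcursion exc

-- Decomposing a rotation

-- A down step crosses D, whose suffixes all have value at most 0, by
-- δ-rotations.  The recursion is on the length of D, since a rotation consumes a
-- whole excursion at once.
push-down : ∀ {n} (δ : IncrementFunction n) A D B → Acc ℕ._<_ (length D) →
            Suffixes≤0 δ (#u A) D → (P Q : DyckPath n) →
            word P ≡ A ++ d ∷ D ++ B → word Q ≡ A ++ D ++ d ∷ B → Tam[ δ ] P ≤ Q
push-down δ A [] B _ _ P Q wP wQ =
  subst (Tam[ δ ] P ≤_) (word-injective {P = P} {Q} (trans wP (sym wQ))) ε
push-down δ A (d ∷ D) B (acc rec) (_ , s) P Q wP wQ =
  push-down δ (A ++ d ∷ []) D B (rec ℕ.≤-refl)
    (subst (λ j → Suffixes≤0 δ j D) (sym (#u-++ A (d ∷ []))) s) P Q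
    (trans wP (sym (++-assoc A _ _))) (trans wQ (sym (++-assoc A _ _)))
push-down δ A (u ∷ D) B (acc rec) s@(p , _) P Q wP wQ
  with excursion-exists δ (#u A) D p
... | C , F , refl , exc = rotation ◅
  push-down δ (A ++ E) F B (rec shorter)
    (subst (λ j → Suffixes≤0 δ j F) (sym (#u-++ A E)) (suffixes≤0-++ʳ δ (#u A) E s)) M Q
    (trans wM (sym (++-assoc A E _)))
    (trans wQ (trans (cong (A ++_) (++-assoc E F _)) (sym (++-assoc A E _))))
  where
  E : List Step
  E = u ∷ C

  wP′ : word P ≡ A ++ d ∷ E ++ F ++ B
  wP′ = trans wP (cong (λ W → A ++ d ∷ W) (++-assoc E F B))

  M : DyckPath _
  M = pushed A E (F ++ B) P wP′

  wM : word M ≡ A ++ E ++ d ∷ F ++ B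
  wM = word-pushed A E (F ++ B) P wP′

  rotation : Rotation δ P M
  rotation = record
    { A = A ; C = E ; B = F ++ B
    ; before = wP′ ; excursion = exc (F ++ B) ; after = wM }

  shorter : length F ℕ.< length (E ++ F)
  shorter = s≤s (subst (length F ℕ.≤_) (sym (length-++ C)) (ℕ.m≤n+m (length F) (length C)))

rotation⇒≤ : ∀ {n} {δ δ′ : IncrementFunction n} → (∀ i → δ i ≤ δ′ i) →
             ∀ {P Q} → Rotation δ′ P Q → Tam[ δ ] P ≤ Q
rotation⇒≤ {δ = δ} δ≤δ′ {P} {Q} r =
  push-down δ A C B (<-wellFounded _)
    (suffixes≤0-antitone δ≤δ′ (#u A) C (excursion⇒suffixes≤0 excursion)) P Q before after
  where open Rotation r

proposition4p10 : ∀ (n : ℕ) (δ δ′ : IncrementFunction n) →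
    (∀ i → δ i ≤ δ′ i) →
    ∀ (P Q : DyckPath n) →
    Tam[ δ′ ] P ⋖ Q →
    Tam[ δ ] P < Q
proposition4p10 n δ δ′ δ≤δ′ P Q ((P≤Q , P≢Q) , _) = (rotation⇒≤ δ≤δ′ ⋆) P≤Q , P≢Q
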